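{- For every reversible cellular automaton $f$ on $\Sigma^{\mathbb Z}$, $$\mathcal{BN}(f)\subseteq\bigl(\mathcal N(f)-\mathcal N(f)+\tilde{\mathcal N}(f)\bigr)\cap\bigl(\tilde{\mathcal N}(f)-\tilde{\mathcal N}(f)+\mathcal N(f)\bigr).$$
   Context: $\Sigma$ is a finite nonempty alphabet. A (one-dimensional) cellular automaton (CA) on $\Sigma$ is a translation-invariant map $f:\Sigma^{\mathbb Z}\to\Sigma^{\mathbb Z}$ for which $f(v)_0$ depends only on finitely many coordinates of $v$; it is reversible if it is bijective (its inverse is then also a CA). For $P,Q\subseteq\mathbb Z$, $P+Q=\{p+q\mid p\in P,q\in Q\}$ and $P-Q=\{p-q\mid p\in P,q\in Q\}$. For $X\subseteq\mathbb Z$, $\bar X=\mathbb Z\setminus X$, and $\Sigma^{\mathbb Z}$ is identified with $\Sigma^X\times\Sigma^{\bar X}$. Neighborhoods: $\mathcal N(f)$ is the smallest $A\subseteq\mathbb Z$ such that $v|_A$ determines $f(v)_0$. The dual of a reversible CA $f$ is $\tilde f=S f^{ -1}S$, where $S(a)_n=a_{ -n}$ on $\Sigma^{\mathbb Z}$, and the dual neighborhood is $\tilde{\mathcal N}(f)=\mathcal N(\tilde f)$. Semilocalizable: a bijection $F:A\times B\to C\times D$ is semilocalizable if there exist a set $E$ and bijections $g:A\to C\times E$ and $h:D\to B\times E$ such that for all $a\in A,b\in B$, $F(a,b)=\bigl(g_C(a),\,h^{ -1}(b,g_E(a))\bigr)$, where $g(a)=(g_C(a),g_E(a))$. For $X,Y\subseteq\mathbb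 Z$, $\mathbf{Q}_X^Y(f)$ is the property: "$f$, seen as a function from $\Sigma^X\times\Sigma^{\bar X}$ to $\Sigma^Y\times\Sigma^{\bar Y}$, is semilocalizable". The block neighborhood $\mathcal{BN}(f)$ is the smallest (for inclusion) $X\subseteq\mathbb Z$ such that $\mathbf{Q}_X^{\{0\}}(f)$ holds. -}

module Defs where

open import Level using (0ℓ; suc)
open import Data.Bool.Base using (Bool; true; false; not; T)
open import Data.Bool.Properties using (T-irrelevant)
open import Data.Empty using (⊥)
open import Data.Integer.Base using (ℤ; 0ℤ; _+_; _-_; -_)
open import Data.Integer.Properties using (_≟_)
open import Data.List.Base using (List)
open import Data.List.Membership.Propositional using () renaming (_∈_ to _∈ᴸ_)
open import Data.Product.Base using (∃; ∃-syntax; _×_; _,_; proj₁; proj₂)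
open import Data.Product.Relation.Binary.Pointwise.NonDependent using (_×ₛ_)
open import Data.Sum.Base using (_⊎_; inj₁; inj₂)
open import Data.Unit.Base using (tt)
open import Function.Base using (_∘_)
open import Function.Bundles using (Func; Bijection; Inverse)
open import Function.Definitions using (Bijective)
import Function.Construct.Composition as Composition
import Function.Construct.Symmetry as Symmetry
open import Function.Properties.Bijection using (Bijection⇒Inverse)
open import Relation.Binary.Bundles using (Setoid)
open import Relation.Binary.PropositionalEquality
  using (_≡_; refl; trans; cong; _→-setoid_)
open import Relation.Nullary.Decidable.Core using (does)
open import Relation.Unary using (Pred; _∈_; _⊆_)

-- The subsets X over which configurations are restricted, and among which
-- smallest ones are taken, are given by characteristic functions: the
-- identification of A^ℤ with A^X × A^X̄ requires membership in X to be
-- decidable.  Classically these are all the subsets of ℤ.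

Subset : Set
Subset = ℤ → Bool

⟦_⟧ : Subset → Pred ℤ 0ℓ
⟦ X ⟧ n = T (X n)

∁ : Subset → Subset
∁ X = not ∘ X

｛0｝ : Subset
｛0｝ n = does (n ≟ 0ℤ)

infixl 8 _⊕_ _⊖_

_⊕_ : Pred ℤ 0ℓ → Pred ℤ 0ℓ → Pred ℤ 0ℓ
(P ⊕ Q) n = ∃[ p ] ∃[ q ] p ∈ P × q ∈ Q × n ≡ p + q

_⊖_ : Pred ℤ 0ℓ → Pred ℤ 0ℓ → Pred ℤ 0ℓ
(P ⊖ Q) n = ∃[ p ] ∃[ q ] p ∈ P × q ∈ Q × n ≡ p - q

IsSmallest : ∀ {ℓ} → Pred Subset ℓ → Pred Subset ℓ
IsSmallest P X = P X × (∀ {Y} → P Y → ⟦ X ⟧ ⊆ ⟦ Y ⟧)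

-- In the absence of function extensionality and quotients, sets are setoids
-- and bijections are `Inverse`s between them; F (a , b) is
-- `to F (a , b)` and h⁻¹ is `from h`.

record Semilocalizable {A B C D : Setoid 0ℓ 0ℓ}
                       (F : Inverse (A ×ₛ B) (C ×ₛ D)) : Set (suc 0ℓ) where
  open Inverse using (to; from)
  field
    E       : Setoid 0ℓ 0ℓ
    g       : Inverse A (C ×ₛ E)
    h       : Inverse D (B ×ₛ E)
    factors : ∀ (a : Setoid.Carrier A) (b : Setoid.Carrier B) →
              Setoid._≈_ (C ×ₛ D)
                (to F (a , b))
                (proj₁ (to g a) , from h (b , proj₂ (to g a)))

module _ (A : Set) where

  Config : Setoid 0ℓ 0ℓ
  Config = ℤ →-setoid A

  -- A^X
  ConfigOn : Subset → Setoid 0ℓ 0ℓ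
  ConfigOn X = ∃ ⟦ X ⟧ →-setoid A

module _ {A : Set} where

  T-or-not : ∀ b → T b ⊎ T (not b)
  T-or-not true  = inj₁ tt
  T-or-not false = inj₂ tt

  not-both : ∀ b → T b → T (not b) → ⊥
  not-both true _ ()

  shift : ℤ → (ℤ → A) → (ℤ → A)
  shift k v n = v (n + k)

  DeterminesAt0 : ((ℤ → A) → (ℤ → A)) → Pred ℤ 0ℓ → Set
  DeterminesAt0 f P = ∀ v w → (∀ n → n ∈ P → v n ≡ w n) → f v 0ℤ ≡ f w 0ℤ

  -- X is 𝒩(f)
  IsNeighborhood : ((ℤ → A) → (ℤ → A)) → Subset → Set
  IsNeighborhood f = IsSmallest λ X → DeterminesAt0 f ⟦ X ⟧

  -- S
  reflect : (ℤ → A) → (ℤ → A)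
  reflect v n = v (- n)

  -- The identification of A^ℤ with A^X × A^X̄.
  joinAt : (X : Subset) → (∃ ⟦ X ⟧ → A) → (∃ ⟦ ∁ X ⟧ → A) →
           (n : ℤ) → T (X n) ⊎ T (not (X n)) → A
  joinAt X a b n (inj₁ p) = a (n , p)
  joinAt X a b n (inj₂ q) = b (n , q)

  joinAt-restrict : ∀ X (v : ℤ → A) n c →
                    joinAt X (v ∘ proj₁) (v ∘ proj₁) n c ≡ v n
  joinAt-restrict X v n (inj₁ _) = refl
  joinAt-restrict X v n (inj₂ _) = refl

  joinAt-cong : ∀ X {a a′ b b′} → (∀ x → a x ≡ a′ x) → (∀ x → b x ≡ b′ x) →
                ∀ n c → joinAt X a b n c ≡ joinAt X a′ b′ n c
  joinAt-cong X p q n (inj₁ _) = p _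
  joinAt-cong X p q n (inj₂ _) = q _

  joinAt-∈ : ∀ X a b n (p : T (X n)) c → joinAt X a b n c ≡ a (n , p)
  joinAt-∈ X a b n p (inj₁ p′) = cong (λ r → a (n , r)) (T-irrelevant p′ p)
  joinAt-∈ X a b n p (inj₂ q) with () ← not-both (X n) p q

  joinAt-∉ : ∀ X a b n (q : T (not (X n))) c → joinAt X a b n c ≡ b (n , q)
  joinAt-∉ X a b n q (inj₁ p) with () ← not-both (X n) p q
  joinAt-∉ X a b n q (inj₂ q′) = cong (λ r → b (n , r)) (T-irrelevant q′ q)

  join : (X : Subset) → (∃ ⟦ X ⟧ → A) → (∃ ⟦ ∁ X ⟧ → A) → (ℤ → A)
  join X a b n = joinAt X a b n (T-or-not (X n))

  split : (X : Subset) → Inverse (Config A) (ConfigOn A X ×ₛ ConfigOn A (∁ X))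
  split X = record
    { to        = λ v → (v ∘ proj₁) , (v ∘ proj₁)
    ; from      = λ (a , b) → join X a b
    ; to-cong   = λ v≈w → (λ x → v≈w (proj₁ x)) , (λ x → v≈w (proj₁ x))
    ; from-cong = λ (p , q) n → joinAt-cong X p q n (T-or-not (X n))
    ; inverse   =
        (λ { {a , b} v≈ → (λ { (n , p) → trans (v≈ n) (joinAt-∈ X a b n p (T-or-not (X n))) })
                        , (λ { (n , q) → trans (v≈ n) (joinAt-∉ X a b n q (T-or-not (X n))) }) })
      , (λ { {v} (p , q) n →
             trans (joinAt-cong X p q n (T-or-not (X n)))
                   (joinAt-restrict X v n (T-or-not (X n))) })
    }

record CellularAutomaton (A : Set) : Set where
  open Setoid (Config A) using (_≈_)
  field
    map                  : Func (Config A) (Config A)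
  open Func map public using (to)
  field
    translationInvariant : ∀ k v → to (shift k v) ≈ shift k (to v)
    local                : ∃ λ (L : List ℤ) → DeterminesAt0 to (λ n → n ∈ᴸ L)

record ReversibleCA (A : Set) : Set where
  open Setoid (Config A) using (_≈_)
  field
    automaton : CellularAutomaton A
  open CellularAutomaton automaton public
  field
    bijective : Bijective _≈_ _≈_ to

  bijection : Bijection (Config A) (Config A)
  bijection = record { to = to ; cong = Func.cong map ; bijective = bijective }

  inverse : Inverse (Config A) (Config A)
  inverse = Bijection⇒Inverse bijection

  -- f̃ = S f⁻¹ S
  dual : (ℤ → A) → (ℤ → A)
  dual = reflect ∘ Inverse.from inverse ∘ reflect

  -- f seen as a function from A^X × A^X̄ to A^Y × A^Ȳ
  asMap : (X Y : Subset) → Inverse (ConfigOn A X ×ₛ ConfigOn A (∁ X))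
                                   (ConfigOn A Y ×ₛ ConfigOn A (∁ Y))
  asMap X Y = Composition.inverse (Symmetry.inverse (split X))
                (Composition.inverse inverse (split Y))

  -- Q_X^Y(f)
  Q : (X Y : Subset) → Set (suc 0ℓ)
  Q X Y = Semilocalizable (asMap X Y)

  -- X is ℬ𝒩(f)
  IsBlockNeighborhood : Subset → Set (suc 0ℓ)
  IsBlockNeighborhood = IsSmallest λ X → Q X ｛0｝

  -- X is 𝒩̃(f)
  IsDualNeighborhood : Subset → Set
  IsDualNeighborhood = IsNeighborhood dual

{-# OPTIONS --safe #-}

-- A bijection F : A × B → C × D is semilocalizable as soon as its C-output
-- depends only on a, the B-component of F⁻¹ depends only on d, and whether
-- F (a , b) and F (a′ , b) agree on D does not depend on b.  For F = f, C = A^{0}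
-- and B = A^X̄ the first two conditions hold when X contains 𝒩 and 𝒩̃, and the
-- third one holds when X contains either of the two sums.  A change of the output
-- at the origin is felt by f⁻¹ in 𝒩̃ only.  If 𝒩 − 𝒩 + 𝒩̃ ⊆ X, then no cell of
-- the output sees both 𝒩̃ and X̄; if 𝒩̃ − 𝒩̃ + 𝒩 ⊆ X, then the output cells from
-- which f⁻¹ computes 𝒩̃ do not see X̄.
--
-- To be able to search through 𝒩̃ we need that it is bounded.  Instead of
-- compactness, an explicit radius for f⁻¹ comes from the pigeonhole principle:
-- if f v and f w agree on a long interval then, on both sides of the origin, some
-- window of (v , w) repeats, and v, w can be made periodic from there on with
-- equal images everywhere, so v and w agree at 0.

module Submission where

open import Defs
open import Data.Nat.Base using (ℕ; suc)
open import Data.Fin.Base using (Fin)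
open import Function.Bundles using (_↔_)
open import Relation.Unary using (_⊆_; _∩_)

open import Level using (0ℓ)
open import Data.Bool.Base using (false)
open import Data.Bool.Properties using (T?)
open import Data.Empty using (⊥-elim)
open import Data.Fin.Base as Fin using (combine)
import Data.Fin.Properties as Fin
open import Data.Integer.Base using (ℤ; +_; -[1+_]; 0ℤ; _+_; _-_; -_; ∣_∣; pred)
  renaming (suc to sucℤ)
import Data.Integer.Properties as ℤ
open import Data.Integer.Tactic.RingSolver using (solve-∀)
open import Data.List.Base using (List; []; _∷_; _++_; length; map; upTo)
open import Data.List.Membership.Propositional using (lose) renaming (_∈_ to _∈ᴸ_)
open import Data.List.Membership.Propositional.Properties
  using (∈-++⁺ˡ; ∈-++⁺ʳ; ∈-map⁺; ∈-upTo⁺)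
open import Data.List.Relation.Unary.Any using (here; there; any?; satisfied)
open import Data.Nat.Base as ℕ using (zero; _≤_; _<_; _^_; s≤s; z≤n)
import Data.Nat.Properties as ℕ
open import Data.Product.Base using (∃₂; ∃-syntax; _×_; _,_; proj₁; proj₂)
open import Data.Product.Properties using (×-≡,≡→≡)
open import Data.Product.Relation.Binary.Pointwise.NonDependent using (_×ₛ_)
open import Data.Sum.Base using (_⊎_; inj₁; inj₂; [_,_]′)
open import Function.Base using (_∘_; const)
open import Function.Bundles using (Inverse; Injection)
open import Function.Definitions using (Injective)
open import Function.Properties.Inverse using (↔⇒↣)
open import Relation.Binary.Bundles using (Setoid)
open import Relation.Binary.PropositionalEquality
open import Relation.Nullary.Decidable as Dec
  using (Dec; yes; no; isYes; toWitness; fromWitness; _×-dec_)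
open import Relation.Nullary.Negation using (contradiction)
open import Relation.Unary using (Pred; Decidable; _∈_; _∉_)

-- Symmetric intervals, successors in ℤ, and eventually periodic walks.

interval : ℕ → List ℤ
interval r = map (+_) (upTo (suc r)) ++ map (-_ ∘ +_) (upTo (suc r))

+∈interval : ∀ {r t} → t ≤ r → + t ∈ᴸ interval r
+∈interval t≤r = ∈-++⁺ˡ (∈-map⁺ (+_) (∈-upTo⁺ (s≤s t≤r)))

-∈interval : ∀ {r t} → t ≤ r → - + t ∈ᴸ interval r
-∈interval {r} t≤r =
  ∈-++⁺ʳ (map (+_) (upTo (suc r))) (∈-map⁺ (-_ ∘ +_) (∈-upTo⁺ (s≤s t≤r)))

∣∣≤⇒∈interval : ∀ {r} n → ∣ n ∣ ≤ r → n ∈ᴸ interval r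
∣∣≤⇒∈interval (+ t)    = +∈interval
∣∣≤⇒∈interval -[1+ t ] = -∈interval

+-sucℤ : ∀ s x → s + sucℤ x ≡ sucℤ s + x
+-sucℤ s x = trans (sym (ℤ.+-assoc s (+ 1) x)) (cong (_+ x) (ℤ.+-comm s (+ 1)))

sucℤ-neg-suc : ∀ m → sucℤ (- + suc m) ≡ - + m
sucℤ-neg-suc zero    = refl
sucℤ-neg-suc (suc m) = refl

-- The walk 0, 1, …, j − 1, i, i + 1, …, j − 1, i, …
walk : ℕ → ℕ → ℕ → ℕ
walk i j zero    = 0
walk i j (suc t) with suc (walk i j t) ℕ.≟ j
... | yes _ = i
... | no  _ = suc (walk i j t)

walk< : ∀ {i j} → i < j → ∀ t → walk i j t < j
walk< i<j zero    = ℕ.≤-<-trans z≤n i<j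
walk< {i} {j} i<j (suc t) with suc (walk i j t) ℕ.≟ j
... | yes _ = i<j
... | no ≢j = ℕ.≤∧≢⇒< (walk< i<j t) ≢j

-- The only step that is not a successor replaces `j` by `i`, and `h` cannot tell these apart.
walk-suc : ∀ {B : Set} i j (h : ℕ → B) → h i ≡ h j →
           ∀ t → h (walk i j (suc t)) ≡ h (suc (walk i j t))
walk-suc i j h hᵢ≡hⱼ t with suc (walk i j t) ℕ.≟ j
... | yes ≡j = trans hᵢ≡hⱼ (cong h (sym ≡j))
... | no  _  = refl

-- Recurring windows and the folding of a configuration.

module _ {B : Set} {b : ℕ} {e : B → Fin b} (e-injective : Injective _≡_ _≡_ e) where

  -- The pattern seen through `P` around `x`, as a number written in base `b`; it lands in a finite
  -- set, ready for the pigeonhole principle.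
  code : (P : List ℤ) → (ℤ → B) → ℤ → Fin (b ^ length P)
  code []      u x = Fin.zero
  code (s ∷ P) u x = combine (e (u (s + x))) (code P u x)

  code-injective : ∀ P u {x y} → code P u x ≡ code P u y →
                   ∀ {s} → s ∈ᴸ P → u (s + x) ≡ u (s + y)
  code-injective (s ∷ P) u eq (here refl) =
    e-injective (Fin.combine-injectiveˡ _ (code P u _) _ (code P u _) eq)
  code-injective (s ∷ P) u {x} {y} eq (there s∈P) =
    code-injective P u
      (Fin.combine-injectiveʳ (e (u (s + x))) _ (e (u (s + y))) _ eq) s∈P

  -- Two of any `b ^ length P + 1` positions carry the same pattern. The bound on `j` does not
  -- depend on `u`, which later makes the radius of f⁻¹ uniform.
  recurrence : ∀ P u (x : ℕ → ℤ) →
               ∃₂ λ i j → i < j × j ≤ b ^ length P ×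
                          (∀ {s} → s ∈ᴸ P → u (s + x i) ≡ u (s + x j))
  recurrence P u x
    with i , j , i<j , eq ← Fin.pigeonhole (ℕ.n<1+n (b ^ length P)) (code P u ∘ x ∘ Fin.toℕ)
    = Fin.toℕ i , Fin.toℕ j , i<j , ℕ.s≤s⁻¹ (Fin.toℕ<n j) , code-injective P u eq

  module Folding (r : ℕ) (u : ℤ → B) where

    bound : ℕ
    bound = b ^ length (interval r)

    -- In each direction, jump back when a window of radius r repeats.
    folding : ∃[ ρ ] ρ 0ℤ ≡ 0ℤ × (∀ n → ∣ ρ n ∣ ≤ bound) ×
              (∀ n {s} → s ∈ᴸ interval r → u (s + ρ (sucℤ n)) ≡ u (s + sucℤ (ρ n)))
    folding
      with i , j , i<j , j≤ , eq ← recurrence (interval r) u (λ t → + t)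
      -- On the left the windows are centred at 1 - t: there `ρ (sucℤ n)` is the earlier step of the
      -- walk, so a jump from `j′` to `i′` shows up in `sucℤ (ρ n)`.
      with i′ , j′ , i′<j′ , j′≤ , eq′ ← recurrence (interval r) u (sucℤ ∘ -_ ∘ +_)
      = ρ , refl , ρ-bounded , ρ-suc
      where
      ρ : ℤ → ℤ
      ρ (+ t)    = + walk i j t
      ρ -[1+ t ] = - + walk i′ j′ (suc t)

      ρ-bounded : ∀ n → ∣ ρ n ∣ ≤ bound
      ρ-bounded (+ t)    = ℕ.≤-trans (ℕ.<⇒≤ (walk< i<j t)) j≤
      ρ-bounded -[1+ t ] = subst (_≤ bound) (sym (ℤ.∣-i∣≡∣i∣ (+ walk i′ j′ (suc t))))
        (ℕ.≤-trans (ℕ.<⇒≤ (walk< i′<j′ (suc t))) j′≤)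

      ρ-neg : ∀ t → ρ (- + t) ≡ - + walk i′ j′ t
      ρ-neg zero    = refl
      ρ-neg (suc t) = refl

      ρ-suc : ∀ n {s} → s ∈ᴸ interval r → u (s + ρ (sucℤ n)) ≡ u (s + sucℤ (ρ n))
      ρ-suc (+ t) {s} s∈ = walk-suc i j (λ t → u (s + + t)) (eq s∈) t
      ρ-suc -[1+ t ] {s} s∈ = begin
        u (s + ρ (sucℤ -[1+ t ]))                   ≡⟨ cong (λ n → u (s + ρ n)) (sucℤ-neg-suc t) ⟩
        u (s + ρ (- + t))                           ≡⟨ cong (λ n → u (s + n)) (ρ-neg t) ⟩
        u (s + - + walk i′ j′ t)                    ≡⟨ cong (λ n → u (s + n)) (sucℤ-neg-suc (walk i′ j′ t)) ⟨
        u (s + sucℤ (- + suc (walk i′ j′ t)))       ≡⟨ walk-suc i′ j′ (λ t → u (s + sucℤ (- + t))) (eq′ s∈) t ⟨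
        u (s + sucℤ (- + walk i′ j′ (suc t)))       ∎
        where open ≡-Reasoning

    ρ : ℤ → ℤ
    ρ = proj₁ folding

    ρ-zero : ρ 0ℤ ≡ 0ℤ
    ρ-zero = proj₁ (proj₂ folding)

    ρ-bounded : ∀ n → ∣ ρ n ∣ ≤ bound
    ρ-bounded = proj₁ (proj₂ (proj₂ folding))

    ρ-suc : ∀ n {s} → s ∈ᴸ interval r → u (s + ρ (sucℤ n)) ≡ u (s + sucℤ (ρ n))
    ρ-suc = proj₂ (proj₂ (proj₂ folding))

    -- Induction moves one unit at a time from `t` to `n`; each move uses `ρ-suc` at an offset that
    -- is still inside the window.
    ρ-+ : ∀ t n → t ≤ r → u (ρ (+ t + n)) ≡ u (+ t + ρ n)
    ρ-+ zero n _ = cong u (trans (cong ρ (ℤ.+-identityˡ n)) (sym (ℤ.+-identityˡ (ρ n))))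
    ρ-+ (suc t) n t<r = begin
      u (ρ (+ suc t + n))   ≡⟨ cong (u ∘ ρ) (+-sucℤ (+ t) n) ⟨
      u (ρ (+ t + sucℤ n))  ≡⟨ ρ-+ t (sucℤ n) (ℕ.<⇒≤ t<r) ⟩
      u (+ t + ρ (sucℤ n))  ≡⟨ ρ-suc n (+∈interval (ℕ.<⇒≤ t<r)) ⟩
      u (+ t + sucℤ (ρ n))  ≡⟨ cong u (+-sucℤ (+ t) (ρ n)) ⟩
      u (+ suc t + ρ n)     ∎
      where open ≡-Reasoning

    ρ-- : ∀ t n → t ≤ r → u (ρ (- + t + n)) ≡ u (- + t + ρ n)
    ρ-- zero n _ = ρ-+ zero n z≤n
    ρ-- (suc t) n t<r = begin
      u (ρ (- + suc t + n))                ≡⟨ cong (λ n → u (ρ (- + suc t + n))) (ℤ.suc-pred n) ⟨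
      u (ρ (- + suc t + sucℤ (pred n)))    ≡⟨ cong (u ∘ ρ) (shorten (pred n)) ⟩
      u (ρ (- + t + pred n))               ≡⟨ ρ-- t (pred n) (ℕ.<⇒≤ t<r) ⟩
      u (- + t + ρ (pred n))               ≡⟨ cong u (shorten (ρ (pred n))) ⟨
      u (- + suc t + sucℤ (ρ (pred n)))    ≡⟨ ρ-suc (pred n) (-∈interval t<r) ⟨
      u (- + suc t + ρ (sucℤ (pred n)))    ≡⟨ cong (λ n → u (- + suc t + ρ n)) (ℤ.suc-pred n) ⟩
      u (- + suc t + ρ n)                  ∎
      where
      open ≡-Reasoning
      shorten : ∀ x → - + suc t + sucℤ x ≡ - + t + x
      shorten x = trans (+-sucℤ (- + suc t) x) (cong (_+ x) (sucℤ-neg-suc t))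

    -- Around `n`, `u ∘ ρ` looks like `u` around `ρ n`, so a rule of radius `r` gives the same value
    -- at both places.
    ρ-window : ∀ s n → ∣ s ∣ ≤ r → u (ρ (s + n)) ≡ u (s + ρ n)
    ρ-window (+ t)    = ρ-+ t
    ρ-window -[1+ t ] = ρ-- (suc t)

-- Bounded sets of integers, decidable sums, and bounds on neighborhoods.

∣∣≤-bound : ∀ L → ∃[ r ] ∀ {n} → n ∈ᴸ L → ∣ n ∣ ≤ r
∣∣≤-bound [] = 0 , λ ()
∣∣≤-bound (m ∷ L) with r , ≤r ← ∣∣≤-bound L = ∣ m ∣ ℕ.⊔ r , λ
  { (here refl) → ℕ.m≤m⊔n ∣ m ∣ r
  ; (there n∈L) → ℕ.≤-trans (≤r n∈L) (ℕ.m≤n⊔m ∣ m ∣ r) }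

ball : ℕ → Subset
ball r n = isYes (∣ n ∣ ℕ.≤? r)

Bounded : Pred ℤ 0ℓ → Set
Bounded P = ∃[ r ] ∀ {n} → n ∈ P → ∣ n ∣ ≤ r

∃∈? : ∀ {P S : Pred ℤ 0ℓ} → Bounded P → Decidable P → Decidable S → Dec (∃[ n ] n ∈ P × n ∈ S)
∃∈? (r , ≤r) P? S? =
  Dec.map′ satisfied (λ (n , n∈P , n∈S) → lose (∣∣≤⇒∈interval n (≤r n∈P)) (n∈P , n∈S))
           (any? (λ n → P? n ×-dec S? n) (interval r))

-- Block neighborhoods are smallest among Boolean subsets, so a sum can compete with them only once
-- it is decidable.
⊖-⊕? : ∀ {P Q R : Pred ℤ 0ℓ} → Bounded P → Decidable P → Bounded Q → Decidable Q →
       Bounded R → Decidable R → Decidable (P ⊖ Q ⊕ R)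
⊖-⊕? P-bounded P? Q-bounded Q? R-bounded R? n = Dec.map′
  (λ (p , p∈P , q , q∈Q , r , r∈R , eq) → p - q , r , (p , q , p∈P , q∈Q , refl) , r∈R , eq)
  (λ { (_ , r , (p , q , p∈P , q∈Q , refl) , r∈R , eq) → p , p∈P , q , q∈Q , r , r∈R , eq })
  (∃∈? P-bounded P? λ p → ∃∈? Q-bounded Q? λ q → ∃∈? R-bounded R? λ r → n ℤ.≟ p - q + r)

IsNeighborhood⇒Bounded : ∀ {A : Set} (f : (ℤ → A) → (ℤ → A)) {N} → IsNeighborhood f N →
  ∀ r → (∀ v w → (∀ n → ∣ n ∣ ≤ r → v n ≡ w n) → f v 0ℤ ≡ f w 0ℤ) → Bounded ⟦ N ⟧
IsNeighborhood⇒Bounded _ (_ , N-least) r determines =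
  r , λ n∈N → toWitness (N-least {ball r}
    (λ v w v≡w → determines v w (λ n ≤r → v≡w n (fromWitness ≤r))) n∈N)

-- With a single letter the empty set already determines the output.
trivial⇒neighborhood-empty : ∀ {A : Set} (f : (ℤ → A) → (ℤ → A)) {N} → IsNeighborhood f N →
  (∀ (x y : A) → x ≡ y) → ∀ {n} → n ∉ ⟦ N ⟧
trivial⇒neighborhood-empty _ (_ , N-least) trivial = N-least {λ _ → false} (λ v w _ → trivial _ _)

-- Translation invariance and locality of f and f⁻¹.

module _ {A : Set} (f : ReversibleCA A) where
  open ReversibleCA f renaming (to to F)
  open Inverse inverse public using () renaming
    ( from to F⁻¹; from-cong to F⁻¹-cong; to-cong to F-cong
    ; strictlyInverseˡ to F∘F⁻¹; strictlyInverseʳ to F⁻¹∘F)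

  F-determined : ∀ {P} → DeterminesAt0 F P → ∀ v w m →
                 (∀ n → n ∈ P → v (n + m) ≡ w (n + m)) → F v m ≡ F w m
  F-determined P-det v w m v≡w = begin
    F v m                ≡⟨ cong (F v) (ℤ.+-identityˡ m) ⟨
    F v (0ℤ + m)         ≡⟨ translationInvariant m v 0ℤ ⟨
    F (shift m v) 0ℤ     ≡⟨ P-det _ _ v≡w ⟩
    F (shift m w) 0ℤ     ≡⟨ translationInvariant m w 0ℤ ⟩
    F w (0ℤ + m)         ≡⟨ cong (F w) (ℤ.+-identityˡ m) ⟩
    F w m                ∎
    where open ≡-Reasoning

  F⁻¹-shift : ∀ k u n → F⁻¹ (shift k u) n ≡ F⁻¹ u (n + k)
  F⁻¹-shift k u n = begin
    F⁻¹ (shift k u) n              ≡⟨ F⁻¹-cong (λ m → F∘F⁻¹ u (m + k)) n ⟨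
    F⁻¹ (shift k (F (F⁻¹ u))) n    ≡⟨ F⁻¹-cong (translationInvariant k (F⁻¹ u)) n ⟨
    F⁻¹ (F (shift k (F⁻¹ u))) n    ≡⟨ F⁻¹∘F (shift k (F⁻¹ u)) n ⟩
    F⁻¹ u (n + k)                  ∎
    where open ≡-Reasoning

  -- The reflections in f̃ turn an offset `p` into `- p`, so f⁻¹ at `n` reads the cells `n - p`.
  F⁻¹-determined : ∀ {P} → DeterminesAt0 dual P → ∀ u u′ n →
                   (∀ p → p ∈ P → u (n - p) ≡ u′ (n - p)) → F⁻¹ u n ≡ F⁻¹ u′ n
  F⁻¹-determined P-det u u′ n u≡u′ = begin
    F⁻¹ u n                                    ≡⟨ as-dual u ⟩
    dual (λ p → u (n - p)) 0ℤ                  ≡⟨ P-det _ _ u≡u′ ⟩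
    dual (λ p → u′ (n - p)) 0ℤ                 ≡⟨ as-dual u′ ⟨
    F⁻¹ u′ n                                   ∎
    where
    open ≡-Reasoning
    index : ∀ m → m + n ≡ n - (- m)
    index m = trans (ℤ.+-comm m n) (cong (λ i → n + i) (sym (ℤ.neg-involutive m)))
    as-dual : ∀ u → F⁻¹ u n ≡ dual (λ p → u (n - p)) 0ℤ
    as-dual u = begin
      F⁻¹ u n                      ≡⟨ cong (F⁻¹ u) (ℤ.+-identityˡ n) ⟨
      F⁻¹ u (0ℤ + n)               ≡⟨ F⁻¹-shift n u 0ℤ ⟨
      F⁻¹ (shift n u) 0ℤ           ≡⟨ F⁻¹-cong (λ m → cong u (index m)) 0ℤ ⟩
      dual (λ p → u (n - p)) 0ℤ    ∎

  F-injective : ∀ {v w} → (∀ n → F v n ≡ F w n) → ∀ n → v n ≡ w n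
  F-injective = proj₁ bijective

  F-radius : ∃[ r ] ∀ v w → (∀ n → ∣ n ∣ ≤ r → v n ≡ w n) → F v 0ℤ ≡ F w 0ℤ
  F-radius
    with L , L-det ← local
    with r , ≤r ← ∣∣≤-bound L
    = r , λ v w v≡w → L-det v w (λ n n∈L → v≡w n (≤r n∈L))

  module _ {k} (A↔Fin : A ↔ Fin k) where

    encode : A × A → Fin (k ℕ.* k)
    encode (x , y) = combine (Inverse.to A↔Fin x) (Inverse.to A↔Fin y)

    encode-injective : Injective _≡_ _≡_ encode
    encode-injective {x , y} {x′ , y′} eq = ×-≡,≡→≡
      ( Injection.injective (↔⇒↣ A↔Fin)
          (Fin.combine-injectiveˡ _ (Inverse.to A↔Fin y) _ (Inverse.to A↔Fin y′) eq)
      , Injection.injective (↔⇒↣ A↔Fin)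
          (Fin.combine-injectiveʳ (Inverse.to A↔Fin x) _ (Inverse.to A↔Fin x′) _ eq))

    -- The radius counts the windows of pairs of letters. Since `ρ` takes no value beyond it, F (v ∘
    -- ρ) and F (w ∘ ρ) agree everywhere; injectivity is then read at 0, which `ρ` fixes.
    F⁻¹-radius : ∃[ R ] ∀ v w → (∀ n → ∣ n ∣ ≤ R → F v n ≡ F w n) → v 0ℤ ≡ w 0ℤ
    F⁻¹-radius = (k ℕ.* k) ^ length (interval r) , agree
      where
      r = proj₁ F-radius
      agree : ∀ v w → (∀ n → ∣ n ∣ ≤ (k ℕ.* k) ^ length (interval r) → F v n ≡ F w n) → v 0ℤ ≡ w 0ℤ
      agree v w Fv≡Fw = begin
        v 0ℤ       ≡⟨ cong v ρ-zero ⟨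
        v (ρ 0ℤ)   ≡⟨ F-injective F[v∘ρ]≡F[w∘ρ] 0ℤ ⟩
        w (ρ 0ℤ)   ≡⟨ cong w ρ-zero ⟩
        w 0ℤ       ∎
        where
        open ≡-Reasoning
        -- Folding the pair makes the windows of `v` and `w` repeat at the same places, so a single
        -- `ρ` serves both.
        open Folding encode-injective r (λ n → v n , w n)
        F[_∘ρ] : ∀ z → (∀ s n → ∣ s ∣ ≤ r → z (ρ (s + n)) ≡ z (s + ρ n)) →
                 ∀ n → F (z ∘ ρ) n ≡ F z (ρ n)
        F[ z ∘ρ] window n = begin
          F (z ∘ ρ) n               ≡⟨ cong (F (z ∘ ρ)) (ℤ.+-identityˡ n) ⟨
          F (z ∘ ρ) (0ℤ + n)        ≡⟨ translationInvariant n (z ∘ ρ) 0ℤ ⟨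
          F (shift n (z ∘ ρ)) 0ℤ    ≡⟨ proj₂ F-radius _ _ (λ s → window s n) ⟩
          F (shift (ρ n) z) 0ℤ      ≡⟨ translationInvariant (ρ n) z 0ℤ ⟩
          F z (0ℤ + ρ n)            ≡⟨ cong (F z) (ℤ.+-identityˡ (ρ n)) ⟩
          F z (ρ n)                 ∎
        F[v∘ρ]≡F[w∘ρ] : ∀ n → F (v ∘ ρ) n ≡ F (w ∘ ρ) n
        F[v∘ρ]≡F[w∘ρ] n = begin
          F (v ∘ ρ) n   ≡⟨ F[ v ∘ρ] (λ s n ≤r → cong proj₁ (ρ-window s n ≤r)) n ⟩
          F v (ρ n)     ≡⟨ Fv≡Fw (ρ n) (ρ-bounded n) ⟩
          F w (ρ n)     ≡⟨ F[ w ∘ρ] (λ s n ≤r → cong proj₂ (ρ-window s n ≤r)) n ⟨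
          F (w ∘ ρ) n   ∎

    dual-radius : ∃[ R ] ∀ v w → (∀ n → ∣ n ∣ ≤ R → v n ≡ w n) → dual v 0ℤ ≡ dual w 0ℤ
    dual-radius = proj₁ F⁻¹-radius , λ v w v≡w → proj₂ F⁻¹-radius _ _ λ n ≤R → begin
      F (F⁻¹ (reflect v)) n   ≡⟨ F∘F⁻¹ (reflect v) n ⟩
      v (- n)                 ≡⟨ v≡w (- n) (subst (_≤ proj₁ F⁻¹-radius) (sym (ℤ.∣-i∣≡∣i∣ n)) ≤R) ⟩
      w (- n)                 ≡⟨ F∘F⁻¹ (reflect w) n ⟨
      F (F⁻¹ (reflect w)) n   ∎
      where open ≡-Reasoning

-- A criterion for semilocalizability.

module _ {A B C D : Setoid 0ℓ 0ℓ} (F : Inverse (A ×ₛ B) (C ×ₛ D)) where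
  private
    module A = Setoid A
    module B = Setoid B
    module C = Setoid C
    module D = Setoid D

  open Inverse F

  -- `g` pairs the C-output of `a` with its class in `E`, and `h⁻¹ (b , a)` is the D-output of
  -- `(a , b)`. The exchange condition makes this class independent of `b₀`, hence `h⁻¹` well
  -- defined.
  semilocalizable : B.Carrier → C.Carrier →
    (∀ a b b′ → proj₁ (to (a , b)) C.≈ proj₁ (to (a , b′))) →
    (∀ c c′ d → proj₂ (from (c , d)) B.≈ proj₂ (from (c′ , d))) →
    (∀ a a′ b b′ → proj₂ (to (a , b)) D.≈ proj₂ (to (a′ , b)) →
                   proj₂ (to (a , b′)) D.≈ proj₂ (to (a′ , b′))) →
    Semilocalizable F
  semilocalizable b₀ c₀ C-indep B-indep exchange = record
    { E = E
    ; g = record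
      { to        = λ a → toC a b₀ , a
      ; from      = λ (c , a) → fromA c (toD a b₀)
      ; to-cong   = λ a≈ → to-cong₁ (a≈ , B.refl) , to-cong₂ (a≈ , B.refl)
      ; from-cong = λ (c≈ , e≈) → from-cong₁ (c≈ , e≈)
      ; inverse   =
          (λ { {c , a} {a′} a′≈ →
              C.trans (to-cong₁ (a′≈ , B.refl)) (toC-fromA c (toD a b₀) b₀)
            , D.trans (to-cong₂ (a′≈ , B.refl))
                      (toD-fromA c (toD a b₀) b₀ (fromB-toD c a b₀)) })
        , (λ { {a} {c , a′} (c≈ , e≈) →
              A.trans (from-cong₁ (c≈ , e≈)) (proj₁ (strictlyInverseʳ (a , b₀))) })
      }
    ; h = record
      -- Any `c₀` will do: preimages of `(c , d)` and `(c₀ , d)` share their B-component and give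
      -- the same D-output, so their A-components are in one class.
      { to        = λ d → fromB c₀ d , fromA c₀ d
      ; from      = λ (b , a) → toD a b
      ; to-cong   = λ d≈ → from-cong₂ (C.refl , d≈) , to-cong₂ (from-cong₁ (C.refl , d≈) , B.refl)
      ; from-cong = λ { {b , a} {b′ , a′} (b≈ , e≈) →
                        D.trans (exchange a a′ b₀ b e≈) (to-cong₂ (A.refl , b≈)) }
      ; inverse   =
          (λ { {b , a} {d} d≈ →
              B.trans (from-cong₂ (C.refl , d≈)) (fromB-toD c₀ a b)
            , exchange _ a b b₀ (D.trans
                (toD-fromA c₀ d b (B.trans (from-cong₂ (C.refl , d≈)) (fromB-toD c₀ a b)))
                d≈) })
        , (λ { {d} {b , a} (b≈ , e≈) →
              D.trans (exchange a _ b₀ b e≈) (toD-fromA c₀ d b (B.sym b≈)) })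
      }
    ; factors = λ a b → C-indep a b b₀ , D.refl
    }
    where
    toC : A.Carrier → B.Carrier → C.Carrier
    toC a b = proj₁ (to (a , b))

    toD : A.Carrier → B.Carrier → D.Carrier
    toD a b = proj₂ (to (a , b))

    fromA : C.Carrier → D.Carrier → A.Carrier
    fromA c d = proj₁ (from (c , d))

    fromB : C.Carrier → D.Carrier → B.Carrier
    fromB c d = proj₂ (from (c , d))

    to-cong₁ : ∀ {a a′ b b′} → a A.≈ a′ × b B.≈ b′ → toC a b C.≈ toC a′ b′
    to-cong₁ p = proj₁ (to-cong p)

    to-cong₂ : ∀ {a a′ b b′} → a A.≈ a′ × b B.≈ b′ → toD a b D.≈ toD a′ b′
    to-cong₂ p = proj₂ (to-cong p)

    from-cong₁ : ∀ {c c′ d d′} → c C.≈ c′ × d D.≈ d′ → fromA c d A.≈ fromA c′ d′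
    from-cong₁ p = proj₁ (from-cong p)

    from-cong₂ : ∀ {c c′ d d′} → c C.≈ c′ × d D.≈ d′ → fromB c d B.≈ fromB c′ d′
    from-cong₂ p = proj₂ (from-cong p)

    -- A modulo the part of the input that D does not see.
    E : Setoid 0ℓ 0ℓ
    E = record
      { Carrier       = A.Carrier
      ; _≈_           = λ a a′ → toD a b₀ D.≈ toD a′ b₀
      ; isEquivalence = record { refl = D.refl ; sym = D.sym ; trans = D.trans }
      }

    toC-fromA : ∀ c d b → toC (fromA c d) b C.≈ c
    toC-fromA c d b =
      C.trans (C-indep (fromA c d) b (fromB c d)) (proj₁ (strictlyInverseˡ (c , d)))

    fromB-toD : ∀ c a b → fromB c (toD a b) B.≈ b
    fromB-toD c a b =
      B.trans (B-indep c (toC a b) (toD a b)) (proj₂ (strictlyInverseʳ (a , b)))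

    toD-fromA : ∀ c d b → fromB c d B.≈ b → toD (fromA c d) b D.≈ d
    toD-fromA c d b eq =
      D.trans (to-cong₂ (A.refl , B.sym eq)) (proj₂ (strictlyInverseˡ (c , d)))

-- Agreement on a subset and gluing.

module _ {A : Set} where

  infix 4 _≈[_]_

  _≈[_]_ : (ℤ → A) → Subset → (ℤ → A) → Set
  v ≈[ X ] w = ∀ n → n ∈ ⟦ X ⟧ → v n ≡ w n

  join-∈ : ∀ X a b n (p : n ∈ ⟦ X ⟧) → join {A} X a b n ≡ a (n , p)
  join-∈ X a b n p = joinAt-∈ X a b n p (T-or-not {A} (X n))

  join-∉ : ∀ X a b n (q : n ∈ ⟦ ∁ X ⟧) → join {A} X a b n ≡ b (n , q)
  join-∉ X a b n q = joinAt-∉ X a b n q (T-or-not {A} (X n))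

  join-≈[] : ∀ X a b b′ → join {A} X a b ≈[ X ] join X a b′
  join-≈[] X a b b′ n p = trans (join-∈ X a b n p) (sym (join-∈ X a b′ n p))

  join-≈[∁] : ∀ X a a′ b → join {A} X a b ≈[ ∁ X ] join X a′ b
  join-≈[∁] X a a′ b n q = trans (join-∉ X a b n q) (sym (join-∉ X a′ b n q))

∈｛0｝⇒≡0 : ∀ {n} → n ∈ ⟦ ｛0｝ ⟧ → n ≡ 0ℤ
∈｛0｝⇒≡0 {n} n∈ with n ℤ.≟ 0ℤ
... | yes n≡0 = n≡0

≢0⇒∈∁｛0｝ : ∀ {n} → n ≢ 0ℤ → n ∈ ⟦ ∁ ｛0｝ ⟧
≢0⇒∈∁｛0｝ {n} n≢0 with n ℤ.≟ 0ℤ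
... | yes n≡0 = contradiction n≡0 n≢0
... | no  _   = _

∈∁⇒∉ : ∀ X {n} → n ∈ ⟦ ∁ X ⟧ → n ∉ ⟦ X ⟧
∈∁⇒∉ X {n} n∈∁ n∈ = not-both {ℤ} (X n) n∈ n∈∁

-- The criterion for f and the two sums.

module _ {A : Set} (f : ReversibleCA A) where
  open ReversibleCA f using (Q; dual) renaming (to to F)

  -- The third condition of the criterion, with v, v′, w, w′ standing for the gluings of (a , b),
  -- (a′ , b), (a , b′), (a′ , b′).
  Exchange : Subset → Set
  Exchange X = ∀ v v′ w w′ → v ≈[ X ] w → v′ ≈[ X ] w′ → v ≈[ ∁ X ] v′ → w ≈[ ∁ X ] w′ →
    F v ≈[ ∁ ｛0｝ ] F v′ → F w ≈[ ∁ ｛0｝ ] F w′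

  Q-intro : A → ∀ X → DeterminesAt0 F ⟦ X ⟧ →
    (∀ u u′ → u ≈[ ∁ ｛0｝ ] u′ → F⁻¹ f u ≈[ ∁ X ] F⁻¹ f u′) →
    Exchange X → Q X ｛0｝
  Q-intro x X X-det stable exchange = semilocalizable (ReversibleCA.asMap f X ｛0｝)
    (const x) (const x)
    (λ { a b b′ (n , n∈) → subst (λ n → F (join X a b) n ≡ F (join X a b′) n) (sym (∈｛0｝⇒≡0 n∈))
                             (X-det _ _ (join-≈[] X a b b′)) })
    (λ { c c′ d (n , n∉) → stable _ _ (join-≈[∁] ｛0｝ c c′ d) n n∉ })
    (λ { a a′ b b′ eq (n , n∉) →
         exchange (join X a b) (join X a′ b) (join X a b′) (join X a′ b′)
           (join-≈[] X a b b′) (join-≈[] X a′ b b′) (join-≈[∁] X a a′ b) (join-≈[∁] X a a′ b′)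
           (λ m m∉ → eq (m , m∉)) n n∉ })

  module _ {N Ñ : Subset} (N-det : DeterminesAt0 F ⟦ N ⟧) (Ñ-det : DeterminesAt0 dual ⟦ Ñ ⟧)
           (N-bounded : Bounded ⟦ N ⟧) where

    -- If `n` is not in 𝒩̃, none of the cells `n - p` that f⁻¹ reads is the origin.
    F⁻¹-unaffected : ∀ u u′ → u ≈[ ∁ ｛0｝ ] u′ → ∀ n → n ∉ ⟦ Ñ ⟧ → F⁻¹ f u n ≡ F⁻¹ f u′ n
    F⁻¹-unaffected u u′ u≈u′ n n∉Ñ = F⁻¹-determined f Ñ-det u u′ n λ p p∈Ñ →
      u≈u′ (n - p) (≢0⇒∈∁｛0｝ λ n-p≡0 → n∉Ñ (subst (_∈ ⟦ Ñ ⟧) (sym (ℤ.i-j≡0⇒i≡j n p n-p≡0)) p∈Ñ))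

    unaffected : ∀ v v′ → F v ≈[ ∁ ｛0｝ ] F v′ → ∀ n → n ∉ ⟦ Ñ ⟧ → v n ≡ v′ n
    unaffected v v′ Fv≈Fv′ n n∉Ñ = begin
      v n               ≡⟨ F⁻¹∘F f v n ⟨
      F⁻¹ f (F v) n     ≡⟨ F⁻¹-unaffected (F v) (F v′) Fv≈Fv′ n n∉Ñ ⟩
      F⁻¹ f (F v′) n    ≡⟨ F⁻¹∘F f v′ n ⟩
      v′ n              ∎
      where open ≡-Reasoning

    -- If 𝒩 and 𝒩̃ are disjoint, then F (F⁻¹ u) 0 cannot depend on u 0.
    intersect-or-trivial : (∃[ p ] p ∈ ⟦ N ⟧ × p ∈ ⟦ Ñ ⟧) ⊎ (∀ (x y : A) → x ≡ y)
    intersect-or-trivial with ∃∈? N-bounded (λ n → T? (N n)) (λ n → T? (Ñ n))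
    ... | yes common = inj₁ common
    ... | no disjoint = inj₂ λ x y →
      let u  = const x
          u′ = join ｛0｝ (const y) (const x)
      in begin
        x                    ≡⟨ F∘F⁻¹ f u 0ℤ ⟨
        F (F⁻¹ f u) 0ℤ       ≡⟨ N-det _ _ (λ n n∈N →
                                  F⁻¹-unaffected u u′ (λ m m∈ → sym (join-∉ ｛0｝ (const y) (const x) m m∈))
                                    n (λ n∈Ñ → disjoint (n , n∈N , n∈Ñ))) ⟩
        F (F⁻¹ f u′) 0ℤ      ≡⟨ F∘F⁻¹ f u′ 0ℤ ⟩
        y                    ∎
      where open ≡-Reasoning

    module _ {X : Subset} (N⊆X : ⟦ N ⟧ ⊆ ⟦ X ⟧) (Ñ⊆X : ⟦ Ñ ⟧ ⊆ ⟦ X ⟧) where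

      Q-from-exchange : A → Exchange X → Q X ｛0｝
      Q-from-exchange x = Q-intro x X
        (λ v w v≈w → N-det v w (λ n n∈N → v≈w n (N⊆X n∈N)))
        (λ u u′ u≈u′ n n∉X → F⁻¹-unaffected u u′ u≈u′ n (∈∁⇒∉ X n∉X ∘ Ñ⊆X))

      -- If 𝒩 + m meets 𝒩̃, it lies in 𝒩 - 𝒩 + 𝒩̃ ⊆ X, and the equality at `m` is inherited from `v`
      -- and `v′`. Otherwise it avoids 𝒩̃, and `w` and `w′` agree on all of it.
      exchange-N-N+Ñ : ⟦ N ⟧ ⊖ ⟦ N ⟧ ⊕ ⟦ Ñ ⟧ ⊆ ⟦ X ⟧ → Exchange X
      exchange-N-N+Ñ ⊆X v v′ w w′ v≈w v′≈w′ v≈v′ w≈w′ Fv≈Fv′ m m≢0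
        with ∃∈? N-bounded (λ n → T? (N n)) (λ n → T? (Ñ (n + m)))
      ... | yes (n , n∈N , n+m∈Ñ) = begin
        F w m     ≡⟨ F-determined f N-det v w m (λ q q∈N → v≈w (q + m) (q+m∈X q∈N)) ⟨
        F v m     ≡⟨ Fv≈Fv′ m m≢0 ⟩
        F v′ m    ≡⟨ F-determined f N-det v′ w′ m (λ q q∈N → v′≈w′ (q + m) (q+m∈X q∈N)) ⟩
        F w′ m    ∎
        where
        open ≡-Reasoning
        regroup : ∀ q n m → q + m ≡ q - n + (n + m)
        regroup = solve-∀
        q+m∈X : ∀ {q} → q ∈ ⟦ N ⟧ → q + m ∈ ⟦ X ⟧
        q+m∈X {q} q∈N = ⊆X (q - n , n + m , (q , n , q∈N , n∈N , refl) , n+m∈Ñ , regroup q n m)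
      ... | no disjoint = F-determined f N-det w w′ m λ q q∈N →
        agree (q + m) (λ q+m∈Ñ → disjoint (q , q∈N , q+m∈Ñ))
        where
        open ≡-Reasoning
        agree : ∀ n → n ∉ ⟦ Ñ ⟧ → w n ≡ w′ n
        agree n n∉Ñ with T-or-not {A} (X n)
        ... | inj₂ n∉X = w≈w′ n n∉X
        ... | inj₁ n∈X = begin
          w n     ≡⟨ v≈w n n∈X ⟨
          v n     ≡⟨ unaffected v v′ Fv≈Fv′ n n∉Ñ ⟩
          v′ n    ≡⟨ v′≈w′ n n∈X ⟩
          w′ n    ∎

      -- The configuration y that F w′ must equal is known; one checks that F⁻¹ y = w′.
      exchange-Ñ-Ñ+N : ⟦ Ñ ⟧ ⊖ ⟦ Ñ ⟧ ⊕ ⟦ N ⟧ ⊆ ⟦ X ⟧ → Exchange X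
      exchange-Ñ-Ñ+N ⊆X v v′ w w′ v≈w v′≈w′ v≈v′ w≈w′ Fv≈Fv′ m m≢0 = begin
        F w m             ≡⟨ y≈Fw m m≢0 ⟨
        y m               ≡⟨ F∘F⁻¹ f y m ⟨
        F (F⁻¹ f y) m     ≡⟨ F-cong f F⁻¹y≡w′ m ⟩
        F w′ m            ∎
        where
        open ≡-Reasoning
        y : ℤ → A
        y = join ｛0｝ (F v′ ∘ proj₁) (F w ∘ proj₁)

        y≈Fw : y ≈[ ∁ ｛0｝ ] F w
        y≈Fw = join-∉ ｛0｝ (F v′ ∘ proj₁) (F w ∘ proj₁)

        F⁻¹y≡w : ∀ n → n ∉ ⟦ Ñ ⟧ → F⁻¹ f y n ≡ w n
        F⁻¹y≡w n n∉Ñ = trans (F⁻¹-unaffected y (F w) y≈Fw n n∉Ñ) (F⁻¹∘F f w n)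

        regroup : ∀ q n p → q + (n - p) ≡ n - p + q
        regroup = solve-∀

        -- Off the origin, the cell `n - p` sees only 𝒩̃ - 𝒩̃ + 𝒩 ⊆ X, where `v` and `w` agree; so F
        -- w = F v = F v′ there. At the origin `y` is F v′ by construction.
        y≡Fv′ : ∀ {n p} → n ∈ ⟦ Ñ ⟧ → p ∈ ⟦ Ñ ⟧ → y (n - p) ≡ F v′ (n - p)
        y≡Fv′ {n} {p} n∈Ñ p∈Ñ = [ join-∈ ｛0｝ (F v′ ∘ proj₁) (F w ∘ proj₁) (n - p) , off-0 ]′
                                (T-or-not {A} (｛0｝ (n - p)))
          where
          off-0 : n - p ∈ ⟦ ∁ ｛0｝ ⟧ → y (n - p) ≡ F v′ (n - p)
          off-0 ∉0 = begin
            y (n - p)       ≡⟨ y≈Fw (n - p) ∉0 ⟩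
            F w (n - p)     ≡⟨ F-determined f N-det v w (n - p) (λ q q∈N → v≈w (q + (n - p))
                                 (⊆X (n - p , q , (n , p , n∈Ñ , p∈Ñ , refl) , q∈N , regroup q n p))) ⟨
            F v (n - p)     ≡⟨ Fv≈Fv′ (n - p) ∉0 ⟩
            F v′ (n - p)    ∎

        F⁻¹y≡w′ : ∀ n → F⁻¹ f y n ≡ w′ n
        F⁻¹y≡w′ n with T-or-not {A} (X n) | T? (Ñ n)
        ... | inj₂ n∉X | _ = trans (F⁻¹y≡w n (∈∁⇒∉ X n∉X ∘ Ñ⊆X)) (w≈w′ n n∉X)
        ... | inj₁ n∈X | yes n∈Ñ = begin
          F⁻¹ f y n         ≡⟨ F⁻¹-determined f Ñ-det y (F v′) n (λ p p∈Ñ → y≡Fv′ n∈Ñ p∈Ñ) ⟩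
          F⁻¹ f (F v′) n    ≡⟨ F⁻¹∘F f v′ n ⟩
          v′ n              ≡⟨ v′≈w′ n n∈X ⟩
          w′ n              ∎
        ... | inj₁ n∈X | no n∉Ñ = begin
          F⁻¹ f y n         ≡⟨ F⁻¹y≡w n n∉Ñ ⟩
          w n               ≡⟨ v≈w n n∈X ⟨
          v n               ≡⟨ unaffected v v′ Fv≈Fv′ n n∉Ñ ⟩
          v′ n              ≡⟨ v′≈w′ n n∈X ⟩
          w′ n              ∎

-- From the exchange property to the inclusion.

⊆-⊖-⊕ˡ : ∀ {P Q : Pred ℤ 0ℓ} {p} → p ∈ P → p ∈ Q → P ⊆ P ⊖ P ⊕ Q
⊆-⊖-⊕ˡ {p = p} p∈P p∈Q {n} n∈P = n - p , p , (n , p , n∈P , p∈P , refl) , p∈Q , regroup n p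
  where
  regroup : ∀ n p → n ≡ n - p + p
  regroup = solve-∀

⊆-⊖-⊕ʳ : ∀ {P Q : Pred ℤ 0ℓ} {p} → p ∈ P → Q ⊆ P ⊖ P ⊕ Q
⊆-⊖-⊕ʳ {p = p} p∈P {n} n∈Q = p - p , n , (p , p , p∈P , p∈P , refl) , n∈Q , regroup n p
  where
  regroup : ∀ n p → n ≡ p - p + n
  regroup = solve-∀

corollary2p2 : ∀ {k : ℕ} {A : Set} → A ↔ Fin (suc k) →
    (f : ReversibleCA A) →
    ∀ {N Ñ BN : Subset} →
    IsNeighborhood (ReversibleCA.to f) N →
    ReversibleCA.IsDualNeighborhood f Ñ →
    ReversibleCA.IsBlockNeighborhood f BN →
    ⟦ BN ⟧ ⊆ ((⟦ N ⟧ ⊖ ⟦ N ⟧ ⊕ ⟦ Ñ ⟧) ∩ (⟦ Ñ ⟧ ⊖ ⟦ Ñ ⟧ ⊕ ⟦ N ⟧))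
corollary2p2 {A = A} A↔Fin f {N} {Ñ} {BN} N-nbhd Ñ-nbhd (_ , BN-least) n∈BN =
    below (⊖-⊕? N-bounded N? N-bounded N? Ñ-bounded Ñ?)
      (covers (ReversibleCA.to f) N-nbhd λ p∈N p∈Ñ → ⊆-⊖-⊕ˡ p∈N p∈Ñ)
      (covers (ReversibleCA.dual f) Ñ-nbhd λ p∈N p∈Ñ → ⊆-⊖-⊕ʳ p∈N)
      (exchange-N-N+Ñ f N-det Ñ-det N-bounded) n∈BN
  , below (⊖-⊕? Ñ-bounded Ñ? Ñ-bounded Ñ? N-bounded N?)
      (covers (ReversibleCA.to f) N-nbhd λ p∈N p∈Ñ → ⊆-⊖-⊕ʳ p∈Ñ)
      (covers (ReversibleCA.dual f) Ñ-nbhd λ p∈N p∈Ñ → ⊆-⊖-⊕ˡ p∈Ñ p∈N)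
      (exchange-Ñ-Ñ+N f N-det Ñ-det N-bounded) n∈BN
  where
  N-det : DeterminesAt0 (ReversibleCA.to f) ⟦ N ⟧
  N-det = proj₁ N-nbhd

  Ñ-det : DeterminesAt0 (ReversibleCA.dual f) ⟦ Ñ ⟧
  Ñ-det = proj₁ Ñ-nbhd

  N-bounded : Bounded ⟦ N ⟧
  N-bounded = IsNeighborhood⇒Bounded (ReversibleCA.to f) N-nbhd _ (proj₂ (F-radius f))

  Ñ-bounded : Bounded ⟦ Ñ ⟧
  Ñ-bounded = IsNeighborhood⇒Bounded (ReversibleCA.dual f) Ñ-nbhd _ (proj₂ (dual-radius f A↔Fin))

  N? : Decidable ⟦ N ⟧
  N? n = T? (N n)

  Ñ? : Decidable ⟦ Ñ ⟧
  Ñ? n = T? (Ñ n)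

  -- A common point of 𝒩 and 𝒩̃ puts `M` inside the sum; failing that, there is only one letter and
  -- `M` is empty.
  covers : ∀ (g : (ℤ → A) → (ℤ → A)) {M} {S : Pred ℤ 0ℓ} → IsNeighborhood g M →
           (∀ {p} → p ∈ ⟦ N ⟧ → p ∈ ⟦ Ñ ⟧ → ⟦ M ⟧ ⊆ S) → ⟦ M ⟧ ⊆ S
  covers g M-nbhd M⊆S n∈M with intersect-or-trivial f N-det Ñ-det N-bounded
  ... | inj₁ (p , p∈N , p∈Ñ) = M⊆S p∈N p∈Ñ n∈M
  ... | inj₂ trivial = ⊥-elim (trivial⇒neighborhood-empty g M-nbhd trivial n∈M)

  -- Deciding `S` turns it into a Boolean subset with the property that ℬ𝒩 is smallest for.
  below : ∀ {S : Pred ℤ 0ℓ} → Decidable S → ⟦ N ⟧ ⊆ S → ⟦ Ñ ⟧ ⊆ S →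
          (∀ {X} → ⟦ N ⟧ ⊆ ⟦ X ⟧ → ⟦ Ñ ⟧ ⊆ ⟦ X ⟧ → S ⊆ ⟦ X ⟧ → Exchange f X) → ⟦ BN ⟧ ⊆ S
  below {S} S? N⊆S Ñ⊆S exchange n∈BN = toWitness (BN-least {X}
    -- There are `suc k` letters, so `Fin.zero` names one.
    (Q-from-exchange f N-det Ñ-det N-bounded N⊆X Ñ⊆X (Inverse.from A↔Fin Fin.zero)
      (exchange N⊆X Ñ⊆X fromWitness)) n∈BN)
    where
    X : Subset
    X n = isYes (S? n)

    N⊆X : ⟦ N ⟧ ⊆ ⟦ X ⟧
    N⊆X n∈N = fromWitness (N⊆S n∈N)

    Ñ⊆X : ⟦ Ñ ⟧ ⊆ ⟦ X ⟧
    Ñ⊆X n∈Ñ = fromWitness (Ñ⊆S n∈Ñ)
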